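{- $|\mathcal{L}_{\rm V}(\mathbb{RDMP})| = |\mathcal{L}_{\rm V}(\mathbb{RDMH})| = |\mathcal{L}_{\rm V}(\mathbb{RDMDBLH})| = |\mathcal{L}_{\rm V}(\mathbb{RDMDBLP})| = 2^{\aleph_0}$, where $\mathcal{L}_{\rm V}(\mathbb V)$ denotes the lattice of subvarieties of the variety $\mathbb V$.
   Context: A De Morgan algebra is a bounded distributive lattice with a unary operation ${}'$ satisfying $x''\approx x$, $(x\vee y)'\approx x'\wedge y'$, $(x\wedge y)'\approx x'\vee y'$, $0'\approx1$, $1'\approx0$. All algebras below have a De Morgan algebra reduct $\langle A,\vee,\wedge,{}',0,1\rangle$. Notation for the further operations: $x^*$ is the largest $z$ with $x\wedge z=0$; $x^+$ is the least $z$ with $x\vee z=1$; $x\to y$ is the largest $z$ with $x\wedge z\le y$; $x\leftarrow y$ is the least $z$ with $y\le x\vee z$. Where ${}^*$ is not basic, $x^*:=x\to0$. The regularity identity is (M1): $(x\wedge x'{}^*{}')\vee(y\vee y^*)\approx y\vee y^*$, where $x'{}^*{}'=((x')^*)'$. $\mathbb{RDMP}$ (regular De Morgan p-algebras): algebras $\langle A,\vee,\wedge,{}^*,{}',0,1\rangle$ satisfying (M1). $\mathbb{RDMH}$ (regular De Morgan Heyting algebras): algebras $\langle A,\vee,\wedge,\to,{}',0,1\rangle$ satisfying (M1). $\mathbb{RDMDBLH}$ (regular De Morgan double Heyting algebras): algebras $\langle A,\vee,\wedge,\to,\leftarrow,{}',0,1\rangle$ satisfying (M1). $\mathbb{RDMDBLP}$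 (regular De Morgan double p-algebras): algebras $\langle A,\vee,\wedge,{}^*,{}^+,{}',0,1\rangle$ satisfying (M1). -}

module Defs where

open import Algebra.Core using (Op₁; Op₂)
import Algebra.Definitions as AlgDefs
import Algebra.Lattice.Structures as LatticeStructures
open import Data.Bool.Base using (Bool)
open import Data.Nat.Base using (ℕ)
open import Data.Product.Base using (_×_; _,_; ∃)
open import Data.Sum.Base using (_⊎_; inj₁; inj₂; [_,_]′)
open import Data.Vec.Base using (Vec; []; _∷_)
open import Data.Vec.Relation.Binary.Pointwise.Inductive using (Pointwise)
open import Function.Bundles using (Bijection)
open import Level using (0ℓ; suc; _⊔_)
open import Relation.Binary.Bundles using (Setoid; Poset)
import Relation.Binary.Construct.NaturalOrder.Left as NaturalOrder
import Relation.Binary.Construct.On as On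
open import Relation.Binary.PropositionalEquality using (_→-setoid_)
open import Relation.Unary using (Pred; _⊆_; _≐_)
open import Relation.Unary.Relation.Binary.Subset using (⊆-poset)

------------------------------------------------------------------------

record Signature : Set₁ where
  field
    Op    : Set
    arity : Op → ℕ

-- The equality of an algebra is the equivalence relation of its carrier
-- setoid, so that quotient algebras exist.
record Algebra (S : Signature) : Set₁ where
  open Signature S
  field
    setoid : Setoid 0ℓ 0ℓ
  open Setoid setoid public
  field
    interp      : (f : Op) → Vec Carrier (arity f) → Carrier
    interp-cong : (f : Op) {xs ys : Vec Carrier (arity f)} →
                  Pointwise _≈_ xs ys → interp f xs ≈ interp f ys

module _ (S : Signature) where
  open Signature S

  data Term : Set where
    var : ℕ → Term
    op  : (f : Op) → Vec Term (arity f) → Term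

  Identity : Set
  Identity = Term × Term

module _ {S : Signature} (A : Algebra S) where
  open Algebra A

  mutual
    eval : (ℕ → Carrier) → Term S → Carrier
    eval ρ (var n)   = ρ n
    eval ρ (op f ts) = interp f (evals ρ ts)

    evals : (ℕ → Carrier) → {n : ℕ} → Vec (Term S) n → Vec Carrier n
    evals ρ []       = []
    evals ρ (t ∷ ts) = eval ρ t ∷ evals ρ ts

  Satisfies : Pred (Identity S) 0ℓ
  Satisfies (s , t) = (ρ : ℕ → Carrier) → eval ρ s ≈ eval ρ t

module _ {S : Signature} where

  Mod : Pred (Identity S) 0ℓ → Pred (Algebra S) 0ℓ
  Mod E A = E ⊆ Satisfies A

  -- A variety is a class of algebras axiomatised by a set of identities.
  IsVariety : Pred (Algebra S) 0ℓ → Set₁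
  IsVariety K = ∃ λ (E : Pred (Identity S) 0ℓ) → K ≐ Mod E

  record Subvariety (V : Pred (Algebra S) 0ℓ) : Set₁ where
    field
      class     : Pred (Algebra S) 0ℓ
      isVariety : IsVariety class
      class⊆V   : class ⊆ V

  -- The subvarieties of V ordered by inclusion; two of them are equal when
  -- they contain the same algebras, whatever identities axiomatise them.
  𝓛 : Pred (Algebra S) 0ℓ → Poset (suc 0ℓ) (suc 0ℓ) (suc 0ℓ)
  𝓛 V = On.poset (⊆-poset (Algebra S) 0ℓ) (Subvariety.class {V})

------------------------------------------------------------------------

∣_∣ : ∀ {a ℓ₁ ℓ₂} → Poset a ℓ₁ ℓ₂ → Setoid a ℓ₁
∣ P ∣ = Poset.Eq.setoid P

infix 4 _≃_

_≃_ : ∀ {a b ℓ₁ ℓ₂} → Setoid a ℓ₁ → Setoid b ℓ₂ → Set (a ⊔ b ⊔ ℓ₁ ⊔ ℓ₂)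
X ≃ Y = Bijection X Y

2^ℵ₀ : Setoid 0ℓ 0ℓ
2^ℵ₀ = ℕ →-setoid Bool

------------------------------------------------------------------------

data DMOp : Set where
  join meet neg bot top : DMOp

dmArity : DMOp → ℕ
dmArity join = 2
dmArity meet = 2
dmArity neg  = 1
dmArity bot  = 0
dmArity top  = 0

DeMorgan+ : (X : Set) → (X → ℕ) → Signature
DeMorgan+ X ar = record { Op = DMOp ⊎ X ; arity = [ dmArity , ar ]′ }

data POp : Set where
  star : POp

data HOp : Set where
  imp : HOp

data DblHOp : Set where
  imp coimp : DblHOp

data DblPOp : Set where
  star plus : DblPOp

DMP DMH DMDBLH DMDBLP : Signature
DMP    = DeMorgan+ POp    λ _ → 1
DMH    = DeMorgan+ HOp    λ _ → 2
DMDBLH = DeMorgan+ DblHOp λ _ → 2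
DMDBLP = DeMorgan+ DblPOp λ _ → 1

------------------------------------------------------------------------

module Reduct {X : Set} {ar : X → ℕ} (A : Algebra (DeMorgan+ X ar)) where
  open Algebra A

  infixr 6 _∨_
  infixr 7 _∧_
  infix  8 _′

  _∨_ _∧_ : Op₂ Carrier
  x ∨ y = interp (inj₁ join) (x ∷ y ∷ [])
  x ∧ y = interp (inj₁ meet) (x ∷ y ∷ [])

  _′ : Op₁ Carrier
  x ′ = interp (inj₁ neg) (x ∷ [])

  𝟎 𝟏 : Carrier
  𝟎 = interp (inj₁ bot) []
  𝟏 = interp (inj₁ top) []

  -- x ≤ y means x ≈ x ∧ y
  open NaturalOrder _≈_ _∧_ public using (_≤_)

  record IsDeMorgan : Set where
    field
      isDistributiveLattice :
        LatticeStructures.IsDistributiveLattice _≈_ _∨_ _∧_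
      ∨-identity   : AlgDefs.Identity _≈_ 𝟎 _∨_
      ∧-identity   : AlgDefs.Identity _≈_ 𝟏 _∧_
      ′-involutive : AlgDefs.Involutive _≈_ _′
      ∨-deMorgan   : ∀ x y → (x ∨ y) ′ ≈ x ′ ∧ y ′
      ∧-deMorgan   : ∀ x y → (x ∧ y) ′ ≈ x ′ ∨ y ′
      𝟎′           : 𝟎 ′ ≈ 𝟏
      𝟏′           : 𝟏 ′ ≈ 𝟎

  IsLargest IsLeast : Pred Carrier 0ℓ → Pred Carrier 0ℓ
  IsLargest P m = P m × (∀ z → P z → z ≤ m)
  IsLeast   P m = P m × (∀ z → P z → m ≤ z)

  IsPseudocomplement IsDualPseudocomplement : Op₁ Carrier → Set
  IsPseudocomplement     _* = ∀ x → IsLargest (λ z → x ∧ z ≈ 𝟎) (x *)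
  IsDualPseudocomplement _⁺ = ∀ x → IsLeast   (λ z → x ∨ z ≈ 𝟏) (x ⁺)

  IsImplication IsDualImplication : Op₂ Carrier → Set
  IsImplication     _⇒_ = ∀ x y → IsLargest (λ z → x ∧ z ≤ y) (x ⇒ y)
  IsDualImplication _⇐_ = ∀ x y → IsLeast   (λ z → y ≤ x ∨ z) (x ⇐ y)

  -- (x ∧ x′*′) ∨ (y ∨ y*) ≈ y ∨ y*, with * an argument because it is x → 0 in
  -- the Heyting signatures.
  Regular : Op₁ Carrier → Set
  Regular _* =
    ∀ x y → (x ∧ ((x ′) *) ′) ∨ (y ∨ (y *)) ≈ y ∨ (y *)

------------------------------------------------------------------------

record ℝ𝔻𝕄ℙ (A : Algebra DMP) : Set where
  open Algebra A
  open Reduct A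
  _* : Op₁ Carrier
  x * = interp (inj₂ star) (x ∷ [])
  field
    isDeMorgan         : IsDeMorgan
    isPseudocomplement : IsPseudocomplement _*
    regular            : Regular _*

record ℝ𝔻𝕄ℍ (A : Algebra DMH) : Set where
  open Algebra A
  open Reduct A
  _⇒_ : Op₂ Carrier
  x ⇒ y = interp (inj₂ imp) (x ∷ y ∷ [])
  field
    isDeMorgan    : IsDeMorgan
    isImplication : IsImplication _⇒_
    regular       : Regular (λ x → x ⇒ 𝟎)

record ℝ𝔻𝕄𝔻𝔹𝕃ℍ (A : Algebra DMDBLH) : Set where
  open Algebra A
  open Reduct A
  _⇒_ : Op₂ Carrier
  x ⇒ y = interp (inj₂ imp) (x ∷ y ∷ [])
  _⇐_ : Op₂ Carrier
  x ⇐ y = interp (inj₂ coimp) (x ∷ y ∷ [])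
  field
    isDeMorgan        : IsDeMorgan
    isImplication     : IsImplication _⇒_
    isDualImplication : IsDualImplication _⇐_
    regular           : Regular (λ x → x ⇒ 𝟎)

record ℝ𝔻𝕄𝔻𝔹𝕃ℙ (A : Algebra DMDBLP) : Set where
  open Algebra A
  open Reduct A
  _* : Op₁ Carrier
  x * = interp (inj₂ star) (x ∷ [])
  _⁺ : Op₁ Carrier
  x ⁺ = interp (inj₂ plus) (x ∷ [])
  field
    isDeMorgan             : IsDeMorgan
    isPseudocomplement     : IsPseudocomplement _*
    isDualPseudocomplement : IsDualPseudocomplement _⁺
    regular                : Regular _*

{-# OPTIONS --safe #-}

-- Each of the four varieties has a finite equational basis and countably many identities, so its
-- subvarieties inject into 2^ℵ₀. Conversely, it suffices to find algebras A 0, A 1, … in the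
-- variety and identities e 0, e 1, … such that A m satisfies e n iff m ≢ n: sets of identities e n
-- then define distinct subvarieties. Schröder–Bernstein finishes the proof.
--
-- A symmetric graph without isolated vertices has a double: the bipartite poset of height ≤ 1 with
-- a minimal and a maximal copy of every vertex, swapped by an antitone involution. Its down-sets
-- form a regular De Morgan Heyting algebra, and the dual operations are definable by conjugating
-- with the involution. Restricted to the minimal points, * is complement and t ↦ t*′* says
-- "no neighbour satisfies t", so the algebra interprets the modal logic of the graph, which can
-- say that two loopless vertices lie at distance exactly n + 1. The identity e n denies this, and
-- A n comes from the path on ℕ with a loop at every vertex except 0 and n + 1.
module Submission where

open import Defs
open import Algebra.Core using (Op₁; Op₂)
open import Algebra.Lattice.Bundles using (Lattice)
import Algebra.Lattice.Properties.Lattice as LatticeProperties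
import Algebra.Lattice.Structures as LatticeStructures
open import Axiom.ExcludedMiddle using (ExcludedMiddle)
open import Data.Bool.Base as Bool using (Bool; true; false; T; not)
open import Data.Bool.Properties as Bool using (T-∧; T-∨; not-involutive)
open import Data.List.Base using (List; []; _∷_; _++_)
open import Data.List.Membership.Propositional using (_∈_)
open import Data.List.Relation.Unary.All as All using (All; []; _∷_)
open import Data.List.Relation.Unary.All.Properties using (++⁺; ++⁻)
open import Data.Nat.Base as Nat using (ℕ; zero; s≤s)
open import Data.Nat.Properties as Nat using (even≢odd; suc-injective; *-cancelˡ-≡)
open import Data.Product.Base as Product using (_×_; _,_; proj₁; proj₂; ∃)
open import Data.Sum.Base as Sum using (_⊎_; inj₁; inj₂; [_,_]′)
open import Data.Unit.Base using (tt)
open import Data.Vec.Base using (Vec; []; _∷_)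
open import Data.Vec.Relation.Binary.Pointwise.Inductive using (Pointwise; []; _∷_)
open import Function.Base using (_∘_; id)
open import Function.Bundles using (Injection; _⇔_; mk⇔; Equivalence)
open import Function.Construct.Composition using (bijection; _⇔-∘_)
open import Function.Definitions using (Injective)
open import Function.Properties.Bijection using (Bijection⇒Inverse)
import Function.Properties.Inverse as Inverse
open import Level using (Level; 0ℓ; suc; _⊔_; Lift; lift; lower)
open import Relation.Binary.Bundles using (Setoid)
import Relation.Binary.Construct.On as On
open import Relation.Binary.Definitions using (Symmetric)
open import Relation.Binary.Lattice using () renaming (Lattice to OrderLattice)
open import Relation.Binary.PropositionalEquality
  using (_≡_; _≢_; refl; sym; trans; cong; cong₂; subst; _→-setoid_)
import Relation.Binary.Reasoning.Setoid as ≈-Reasoning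
open import Relation.Nullary using (¬_; Dec; yes; no; contradiction)
open import Relation.Nullary.Decidable using (⌊_⌋; toWitness; fromWitness; map′)
open import Relation.Unary using (Pred; _⊆_)

open Equivalence

private variable
  a ℓa b ℓb : Level

ExcludedMiddle-lower : ∀ a b → ExcludedMiddle (a ⊔ b) → ExcludedMiddle a
ExcludedMiddle-lower a b em {P} = map′ lower lift (em {Lift b P})

T-ext : ∀ {b c} → (T b → T c) → (T c → T b) → b ≡ c
T-ext {false} {false} f g = refl
T-ext {false} {true}  f g = contradiction (g tt) id
T-ext {true}  {false} f g = contradiction (f tt) id
T-ext {true}  {true}  f g = refl

-- The Schröder-Bernstein theorem for setoids.

module _ {X : Setoid a ℓa} {Y : Setoid b ℓb} (em : ExcludedMiddle (a ⊔ ℓa ⊔ b ⊔ ℓb))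
         (F : Injection X Y) (G : Injection Y X) where
  private
    module X = Setoid X
    module Y = Setoid Y
    module F = Injection F
    module G = Injection G

    InImage : X.Carrier → Set (b ⊔ ℓa)
    InImage x = ∃ λ y → G.to y X.≈ x

    -- The backward orbit of x under F and G ends in X.
    data Chain : X.Carrier → Set (a ⊔ b ⊔ ℓa) where
      start : ∀ {x} → ¬ InImage x → Chain x
      step  : ∀ {x x′} → Chain x → G.to (F.to x) X.≈ x′ → Chain x′

    chain? : ∀ x → Dec (Chain x)
    chain? x = ExcludedMiddle-lower (a ⊔ b ⊔ ℓa) ℓb em

    Chain-resp : ∀ {x x′} → x X.≈ x′ → Chain x → Chain x′
    Chain-resp x≈x′ (start ∉)  = start λ (y , gy≈x′) → ∉ (y , X.trans gy≈x′ (X.sym x≈x′))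
    Chain-resp x≈x′ (step c e) = step c (X.trans e x≈x′)

    -- The graph of the bijection under construction. As a relation it can be analysed without
    -- unfolding the decisions and the choice of preimage made by `match`.
    Matched : X.Carrier → Y.Carrier → Set (a ⊔ b ⊔ ℓa ⊔ ℓb)
    Matched x y = (Chain x × F.to x Y.≈ y) ⊎ (¬ Chain x × G.to y X.≈ x)

    match : ∀ x → ∃ (Matched x)
    match x with chain? x
    ... | yes c = F.to x , inj₁ (c , Y.refl)
    ... | no ¬c with ExcludedMiddle-lower (b ⊔ ℓa) (a ⊔ ℓb) em {InImage x}
    ...   | yes (y , gy≈x) = y , inj₂ (¬c , gy≈x)
    -- A point outside the image of `G` would itself start a chain.
    ...   | no ∉           = contradiction (start ∉) ¬c

    Matched-functional : ∀ {x x′ y y′} → Matched x y → Matched x′ y′ → x X.≈ x′ → y Y.≈ y′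
    Matched-functional (inj₁ (_ , e)) (inj₁ (_ , e′)) p =
      Y.trans (Y.sym e) (Y.trans (F.cong p) e′)
    Matched-functional (inj₁ (c , _)) (inj₂ (¬c , _)) p = contradiction (Chain-resp p c) ¬c
    Matched-functional (inj₂ (¬c , _)) (inj₁ (c , _)) p = contradiction (Chain-resp (X.sym p) c) ¬c
    Matched-functional (inj₂ (_ , e)) (inj₂ (_ , e′)) p =
      G.injective (X.trans e (X.trans p (X.sym e′)))

    Matched-injective : ∀ {x x′ y y′} → Matched x y → Matched x′ y′ → y Y.≈ y′ → x X.≈ x′
    Matched-injective (inj₁ (_ , e)) (inj₁ (_ , e′)) p =
      F.injective (Y.trans e (Y.trans p (Y.sym e′)))
    -- The mixed cases are impossible: `G (F x)` equals `x′`, so a chain through `x` continues to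
    -- `x′`.
    Matched-injective (inj₁ (c , e)) (inj₂ (¬c , e′)) p =
      contradiction (step c (X.trans (G.cong (Y.trans e p)) e′)) ¬c
    Matched-injective (inj₂ (¬c , e)) (inj₁ (c , e′)) p =
      contradiction (step c (X.trans (G.cong (Y.trans e′ (Y.sym p))) e)) ¬c
    Matched-injective (inj₂ (_ , e)) (inj₂ (_ , e′)) p =
      X.trans (X.sym e) (X.trans (G.cong p) e′)

    -- The point `G y` lies in the image of `G`, so it starts no chain. If it is on one, it is
    -- `G (F x)` for an earlier `x`, and injectivity of `G` gives that `F x` is `y`; otherwise `G y`
    -- itself is matched with `y`.
    Matched-surjective : ∀ y → ∃ λ x → Matched x y
    Matched-surjective y with chain? (G.to y)
    ... | yes (start ∉)        = contradiction (y , X.refl) ∉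
    ... | yes (step {x} c gfx) = x , inj₁ (c , G.injective gfx)
    ... | no ¬c                = G.to y , inj₂ (¬c , X.refl)

  schröder-bernstein : X ≃ Y
  schröder-bernstein = record
    { to        = proj₁ ∘ match
    ; cong      = Matched-functional (proj₂ (match _)) (proj₂ (match _))
    ; bijective = Matched-injective (proj₂ (match _)) (proj₂ (match _))
                , λ y → let (x , m) = Matched-surjective y in
                    x , Matched-functional (proj₂ (match _)) m
    }

-- Countability of terms and identities.

-- Abstract, so that unification treats pair as injective.
abstract
  pair : ℕ → ℕ → ℕ
  pair zero      n = ℕ.suc (2 Nat.* n)
  pair (ℕ.suc m) n = 2 Nat.* pair m n

  -- The code is 2^m (2n + 1): the exponent of 2 recovers `m` and the odd part recovers `n`.
  pair-injective : ∀ {m m′ n n′} → pair m n ≡ pair m′ n′ → m ≡ m′ × n ≡ n′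
  pair-injective {zero} {zero} eq = refl , *-cancelˡ-≡ _ _ 2 (suc-injective eq)
  pair-injective {zero} {ℕ.suc m′} {n} {n′} eq = contradiction (sym eq) (even≢odd (pair m′ n′) n)
  pair-injective {ℕ.suc m} {zero} {n} {n′} eq = contradiction eq (even≢odd (pair m n) n′)
  pair-injective {ℕ.suc m} {ℕ.suc m′} eq with pair-injective {m} {m′} (*-cancelˡ-≡ _ _ 2 eq)
  ... | refl , n≡n′ = refl , n≡n′

Countable : Set → Set
Countable A = ∃ λ (code : A → ℕ) → Injective _≡_ _≡_ code

module _ {S : Signature} (countable : Countable (Signature.Op S)) where
  open Signature S
  private
    opCode = proj₁ countable

    mutual
      termCode : Term S → ℕ
      termCode (var n)   = pair 0 n
      -- The tag 0 belongs to variables, hence the shift of the symbol code.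
      termCode (op f ts) = pair (ℕ.suc (opCode f)) (termsCode ts)

      termsCode : ∀ {n} → Vec (Term S) n → ℕ
      termsCode []       = 0
      termsCode (t ∷ ts) = pair (termCode t) (termsCode ts)

    mutual
      termCode-injective : ∀ s t → termCode s ≡ termCode t → s ≡ t
      termCode-injective (var m) (var n) eq = cong var (proj₂ (pair-injective eq))
      termCode-injective (var m) (op g us) eq with () ← proj₁ (pair-injective eq)
      termCode-injective (op f ts) (var n) eq with () ← proj₁ (pair-injective eq)
      termCode-injective (op f ts) (op g us) eq with pair-injective eq
      ... | f≡g , ts≡us with proj₂ countable (suc-injective f≡g)
      ... | refl = cong (op f) (termsCode-injective ts us ts≡us)

      -- Codes of vectors do not record the length. Comparing vectors of one length suffices,
      -- because equal symbols have equal arities and the symbols are compared first.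
      termsCode-injective : ∀ {n} (ts us : Vec (Term S) n) → termsCode ts ≡ termsCode us → ts ≡ us
      termsCode-injective []       []       eq = refl
      termsCode-injective (t ∷ ts) (u ∷ us) eq with pair-injective eq
      ... | t≡u , ts≡us
        with refl ← termCode-injective t u t≡u | refl ← termsCode-injective ts us ts≡us = refl

  identity-countable : Countable (Identity S)
  identity-countable = code , λ {e} {e′} → injective e e′
    where
    code : Identity S → ℕ
    code (s , t) = pair (termCode s) (termCode t)

    injective : ∀ e e′ → code e ≡ code e′ → e ≡ e′
    injective (s , t) (s′ , t′) eq with pair-injective eq
    ... | s≡s′ , t≡t′
      with refl ← termCode-injective s s′ s≡s′ | refl ← termCode-injective t t′ t≡t′ = refl

-- Subvarieties and sets of natural numbers.

module _ {S : Signature} (V : Pred (Algebra S) 0ℓ) where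

  -- The invariant is the equational theory, recorded as a Boolean sequence indexed by codes of
  -- identities; it determines a variety, which is the class of models of its theory. Validity in a
  -- class quantifies over all algebras, hence excluded middle one level up.
  𝓛-injects : ExcludedMiddle (suc 0ℓ) → Countable (Signature.Op S) → Injection ∣ 𝓛 V ∣ 2^ℵ₀
  𝓛-injects em countable = record
    { to        = theory
    ; cong      = λ {W} {W′} (W⊆W′ , W′⊆W) n → T-ext
        (theory-antitone {W} {W′} W′⊆W n) (theory-antitone {W′} {W} W⊆W′ n)
    ; injective = λ {W} {W′} eq →
        class⊆ {W} {W′} (λ n → subst T (sym (eq n))) , class⊆ {W′} {W} (λ n → subst T (eq n))
    }
    where
    open Subvariety

    code = proj₁ (identity-countable countable)

    Valid : Subvariety V → Identity S → Set₁
    Valid W e = W .class ⊆ λ A → Satisfies A e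

    -- A number that codes no identity gets the value `false`.
    valid? : ∀ W n → Dec (∃ λ e → code e ≡ n × Valid W e)
    valid? W n = em

    theory : Subvariety V → ℕ → Bool
    theory W n = ⌊ valid? W n ⌋

    theory-antitone : ∀ {W W′} → W′ .class ⊆ W .class → ∀ n → T (theory W n) → T (theory W′ n)
    theory-antitone {W} {W′} W′⊆W n p with toWitness {a? = valid? W n} p
    ... | e , eq , ok = fromWitness {a? = valid? W′ n} (e , eq , ok ∘ W′⊆W)

    class⊆ : ∀ {W W′} → (∀ n → T (theory W′ n) → T (theory W n)) → W .class ⊆ W′ .class
    class⊆ {W} {W′} inc {A} A∈W with W′ .isVariety
    ... | E , W′⊆E , E⊆W′ = E⊆W′ λ {e} e∈E →
      -- The axiom `e` of `W′` is in the theory of `W′`, hence in that of `W`. Decoding yields some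
      -- `e₁` with the code of `e`, and the two agree because `code` is injective.
      let e₁ , eq , ok = toWitness {a? = valid? W (code e)} (inc (code e)
                           (fromWitness {a? = valid? W′ (code e)}
                             (e , refl , λ B∈W′ → W′⊆E B∈W′ e∈E)))
      in subst (Satisfies A) (proj₂ (identity-countable countable) {e₁} {e} eq) (ok A∈W)

  module _ (isVariety : IsVariety V) (identity : ℕ → Identity S) (algebra : ℕ → Algebra S)
           (algebra∈V : ∀ n → V (algebra n))
           (separates : ∀ m n → Satisfies (algebra m) (identity n) ⇔ m ≢ n) where

    private
      subvariety : (ℕ → Bool) → Subvariety V
      subvariety s = record
        { class     = λ A → V A × (∀ n → s n ≡ true → Satisfies A (identity n))
        ; isVariety = (λ e → E e ⊎ ∃ λ n → s n ≡ true × identity n ≡ e)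
                    , (λ { (v , h) (inj₁ e∈E) → V⊆E v e∈E
                         ; (v , h) (inj₂ (n , p , refl)) → h n p })
                    , λ h → E⊆V (h ∘ inj₁) , λ n p → h (inj₂ (n , p , refl))
        ; class⊆V   = proj₁
        }
        where
        E   = proj₁ isVariety
        V⊆E = proj₁ (proj₂ isVariety)
        E⊆V = proj₂ (proj₂ isVariety)

      open Subvariety

      -- Among the identities of the family, `algebra n` violates exactly `identity n`, so its
      -- membership reads off the bit `s n`. This is how `s` is recovered from `subvariety s`.
      algebra∈⇔ : ∀ s n → subvariety s .class (algebra n) ⇔ s n ≡ false
      algebra∈⇔ s n = mk⇔ (⇒ (s n) refl) ⇐
        where
        ⇒ : ∀ b → s n ≡ b → subvariety s .class (algebra n) → b ≡ false
        ⇒ false _  _       = refl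
        ⇒ true  eq (_ , h) = contradiction refl (separates n n .to (h n eq))

        ⇐ : s n ≡ false → subvariety s .class (algebra n)
        ⇐ p = algebra∈V n , λ m q → separates n m .from λ { refl → contradiction (trans (sym p) q) λ () }

    2^ℵ₀-injects : Injection 2^ℵ₀ ∣ 𝓛 V ∣
    2^ℵ₀-injects = record
      { to        = subvariety
      ; cong      = λ s≗s′ → (λ (v , h) → v , λ n p → h n (trans (s≗s′ n) p))
                            , (λ (v , h) → v , λ n p → h n (trans (sym (s≗s′ n)) p))
      ; injective = λ {s} {s′} (s⊆s′ , s′⊆s) n → false-ext
          (λ p → algebra∈⇔ s′ n .to (s⊆s′ (algebra∈⇔ s n .from p)))
          (λ p → algebra∈⇔ s n .to (s′⊆s (algebra∈⇔ s′ n .from p)))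
      }
      where
      false-ext : ∀ {b c} → (b ≡ false → c ≡ false) → (c ≡ false → b ≡ false) → b ≡ c
      false-ext {false} f g = sym (f refl)
      false-ext {true} {true}  f g = refl
      false-ext {true} {false} f g = g refl

    𝓛≃2^ℵ₀ : ExcludedMiddle (suc 0ℓ) → Countable (Signature.Op S) → ∣ 𝓛 V ∣ ≃ 2^ℵ₀
    𝓛≃2^ℵ₀ em countable = schröder-bernstein em (𝓛-injects em countable) 2^ℵ₀-injects

-- Finite equational bases for the four varieties.

finitelyBased⇒isVariety : ∀ {S} {K : Pred (Algebra S) 0ℓ} (E : List (Identity S)) →
                          (∀ A → K A ⇔ All (Satisfies A) E) → IsVariety K
finitelyBased⇒isVariety E K⇔E = (_∈ E)
  , (λ {A} k → All.lookup (K⇔E A .to k))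
  , (λ {A} h → K⇔E A .from (All.tabulate h))

module _ {X : Set} {ar : X → ℕ} (A : Algebra (DeMorgan+ X ar)) where
  open Algebra A renaming (refl to ≈-refl; sym to ≈-sym; trans to ≈-trans)
  open Reduct A

  module DeMorganProperties (isDeMorgan : IsDeMorgan) where
    open IsDeMorgan isDeMorgan public
    open LatticeStructures.IsDistributiveLattice isDistributiveLattice public
      using (isLattice; ∨-comm; ∨-assoc; ∨-cong; ∧-comm; ∧-assoc; ∧-congˡ; absorptive
            ; ∨-distrib-∧; ∧-distrib-∨)

    lattice : Lattice 0ℓ 0ℓ
    lattice = record { isLattice = isLattice }

    open OrderLattice (LatticeProperties.∨-∧-orderTheoreticLattice lattice) public
      using (x≤x∨y; y≤x∨y; ∨-least; antisym)
      renaming (trans to ≤-trans; refl to ≤-refl; reflexive to ≤-reflexive)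

    ′-cong : ∀ {x y} → x ≈ y → x ′ ≈ y ′
    ′-cong x≈y = interp-cong (inj₁ neg) (x≈y ∷ [])

    𝟎-minimum : ∀ x → 𝟎 ≤ x
    𝟎-minimum x = ≤-trans (x≤x∨y 𝟎 x) (≤-reflexive (proj₁ ∨-identity x))

    ≤𝟎⇒≈𝟎 : ∀ {x} → x ≤ 𝟎 → x ≈ 𝟎
    ≤𝟎⇒≈𝟎 x≤𝟎 = antisym x≤𝟎 (𝟎-minimum _)

    ≤⇒∨≈ : ∀ {x y} → x ≤ y → x ∨ y ≈ y
    ≤⇒∨≈ x≤y = antisym (∨-least x≤y ≤-refl) (y≤x∨y _ _)

    ′-antitone : ∀ {x y} → x ≤ y → y ′ ≤ x ′
    ′-antitone {x} {y} x≤y =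
      ≤-trans (y≤x∨y (x ′) (y ′))
              (≤-reflexive (≈-trans (≈-sym (∧-deMorgan x y)) (′-cong (≈-sym x≤y))))

    x≤y′⇒y≤x′ : ∀ {x y} → x ≤ y ′ → y ≤ x ′
    x≤y′⇒y≤x′ x≤y′ = ≤-trans (≤-reflexive (≈-sym (′-involutive _))) (′-antitone x≤y′)

    x′≤y⇒y′≤x : ∀ {x y} → x ′ ≤ y → y ′ ≤ x
    x′≤y⇒y′≤x x′≤y = ≤-trans (′-antitone x′≤y) (≤-reflexive (′-involutive _))

    implication⇒pseudocomplement : ∀ {_⇒_} → IsImplication _⇒_ → IsPseudocomplement (_⇒ 𝟎)
    implication⇒pseudocomplement isImp x =
      ≤𝟎⇒≈𝟎 (proj₁ (isImp x 𝟎)) , λ z x∧z≈𝟎 → proj₂ (isImp x 𝟎) z (≤-reflexive x∧z≈𝟎)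

    -- The involution reverses the order and exchanges `_∧_` with `_∨_`, so it carries a largest
    -- solution to a least solution of the dual problem.
    implication⇒dualImplication : ∀ {_⇒_} → IsImplication _⇒_ →
                                  IsDualImplication (λ x y → ((x ′) ⇒ (y ′)) ′)
    implication⇒dualImplication {_⇒_} isImp x y =
      ≤-trans (x≤y′⇒y≤x′ (proj₁ (isImp (x ′) (y ′))))
              (≤-reflexive (≈-trans (∧-deMorgan _ _) (∨-cong (′-involutive x) ≈-refl)))
      , λ z y≤x∨z → x′≤y⇒y′≤x (proj₂ (isImp (x ′) (y ′)) (z ′)
          (≤-trans (≤-reflexive (≈-sym (∨-deMorgan x z))) (′-antitone y≤x∨z)))

    pseudocomplement⇒dualPseudocomplement : ∀ {_*} → IsPseudocomplement _* →
                                            IsDualPseudocomplement (λ x → ((x ′) *) ′)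
    pseudocomplement⇒dualPseudocomplement {_*} psc x =
      (begin
        x ∨ ((x ′) *) ′       ≈⟨ ∨-cong (′-involutive x) ≈-refl ⟨
        (x ′) ′ ∨ ((x ′) *) ′   ≈⟨ ∧-deMorgan (x ′) ((x ′) *) ⟨
        (x ′ ∧ ((x ′) *)) ′     ≈⟨ ′-cong (proj₁ (psc (x ′))) ⟩
        𝟎 ′                   ≈⟨ 𝟎′ ⟩
        𝟏                     ∎)
      , λ z x∨z≈𝟏 → x′≤y⇒y′≤x (proj₂ (psc (x ′)) (z ′)
          (≈-trans (≈-sym (∨-deMorgan x z)) (≈-trans (′-cong x∨z≈𝟏) 𝟏′)))
      where open ≈-Reasoning setoid

    IsLeast-unique : ∀ {P m n} → IsLeast P m → IsLeast P n → m ≈ n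
    IsLeast-unique (Pm , m≤) (Pn , n≤) = antisym (m≤ _ Pn) (n≤ _ Pm)

    -- Least elements are unique, so any dual implication agrees with the conjugate of the
    -- implication. One identity can therefore replace the order condition in the basis.
    dualImplication⇔ : ∀ {_⇒_ _⇐_} → IsImplication _⇒_ →
                       IsDualImplication _⇐_ ⇔ (∀ x y → (x ⇐ y) ≈ ((x ′) ⇒ (y ′)) ′)
    dualImplication⇔ {_⇒_} {_⇐_} isImp = mk⇔
      (λ isDual x y → IsLeast-unique (isDual x y) (dual x y))
      (λ eq x y → ≤-trans (proj₁ (dual x y)) (≤-reflexive (∨-cong ≈-refl (≈-sym (eq x y))))
                , λ z h → ≤-trans (≤-reflexive (eq x y)) (proj₂ (dual x y) z h))
      where dual = implication⇒dualImplication {_⇒_} isImp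

    dualPseudocomplement⇔ : ∀ {_* _⁺} → IsPseudocomplement _* →
                            IsDualPseudocomplement _⁺ ⇔ (∀ x → x ⁺ ≈ ((x ′) *) ′)
    dualPseudocomplement⇔ {_*} {_⁺} psc = mk⇔
      (λ dpsc x → IsLeast-unique (dpsc x) (dual x))
      (λ eq x → ≈-trans (∨-cong ≈-refl (eq x)) (proj₁ (dual x))
              , λ z h → ≤-trans (≤-reflexive (eq x)) (proj₂ (dual x) z h))
      where dual = pseudocomplement⇒dualPseudocomplement {_*} psc

  -- The axioms below use at most the variables 0, 1 and 2; all later variables share the value `z`.
  valuation : Carrier → Carrier → Carrier → ℕ → Carrier
  valuation x y z 0               = x
  valuation x y z 1               = y
  valuation x y z (ℕ.suc (ℕ.suc _)) = z

module _ {X : Set} {ar : X → ℕ} where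

  infixr 6 _∨ᵗ_
  infixr 7 _∧ᵗ_
  infix  8 _′ᵗ
  infix  4 _≤ᵗ_

  _∨ᵗ_ _∧ᵗ_ : Op₂ (Term (DeMorgan+ X ar))
  s ∨ᵗ t = op (inj₁ join) (s ∷ t ∷ [])
  s ∧ᵗ t = op (inj₁ meet) (s ∷ t ∷ [])

  _′ᵗ : Op₁ (Term (DeMorgan+ X ar))
  t ′ᵗ = op (inj₁ neg) (t ∷ [])

  0ᵗ 1ᵗ : Term (DeMorgan+ X ar)
  0ᵗ = op (inj₁ bot) []
  1ᵗ = op (inj₁ top) []

  _≤ᵗ_ : Term (DeMorgan+ X ar) → Term (DeMorgan+ X ar) → Identity (DeMorgan+ X ar)
  s ≤ᵗ t = s , s ∧ᵗ t

  deMorganAxioms : List (Identity (DeMorgan+ X ar))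
  deMorganAxioms =
      (x ∨ᵗ y , y ∨ᵗ x)
    ∷ ((x ∨ᵗ y) ∨ᵗ z , x ∨ᵗ (y ∨ᵗ z))
    ∷ (x ∧ᵗ y , y ∧ᵗ x)
    ∷ ((x ∧ᵗ y) ∧ᵗ z , x ∧ᵗ (y ∧ᵗ z))
    ∷ (x ∨ᵗ (x ∧ᵗ y) , x)
    ∷ (x ∧ᵗ (x ∨ᵗ y) , x)
    ∷ (x ∨ᵗ (y ∧ᵗ z) , (x ∨ᵗ y) ∧ᵗ (x ∨ᵗ z))
    ∷ ((y ∧ᵗ z) ∨ᵗ x , (y ∨ᵗ x) ∧ᵗ (z ∨ᵗ x))
    ∷ (x ∧ᵗ (y ∨ᵗ z) , (x ∧ᵗ y) ∨ᵗ (x ∧ᵗ z))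
    ∷ ((y ∨ᵗ z) ∧ᵗ x , (y ∧ᵗ x) ∨ᵗ (z ∧ᵗ x))
    ∷ (0ᵗ ∨ᵗ x , x)
    ∷ (x ∨ᵗ 0ᵗ , x)
    ∷ (1ᵗ ∧ᵗ x , x)
    ∷ (x ∧ᵗ 1ᵗ , x)
    ∷ (x ′ᵗ ′ᵗ , x)
    ∷ ((x ∨ᵗ y) ′ᵗ , x ′ᵗ ∧ᵗ y ′ᵗ)
    ∷ ((x ∧ᵗ y) ′ᵗ , x ′ᵗ ∨ᵗ y ′ᵗ)
    ∷ (0ᵗ ′ᵗ , 1ᵗ)
    ∷ (1ᵗ ′ᵗ , 0ᵗ)
    ∷ []
    where x = var 0; y = var 1; z = var 2

  isDeMorgan⇔ : ∀ A → Reduct.IsDeMorgan A ⇔ All (Satisfies A) deMorganAxioms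
  isDeMorgan⇔ A = mk⇔ ⇒ ⇐
    where
    open Algebra A renaming (refl to ≈-refl; sym to ≈-sym; trans to ≈-trans)
    open Reduct A

    ⇒ : IsDeMorgan → All (Satisfies A) deMorganAxioms
    ⇒ dm =
        (λ ρ → ∨-comm _ _)
      ∷ (λ ρ → ∨-assoc _ _ _)
      ∷ (λ ρ → ∧-comm _ _)
      ∷ (λ ρ → ∧-assoc _ _ _)
      ∷ (λ ρ → proj₁ absorptive _ _)
      ∷ (λ ρ → proj₂ absorptive _ _)
      ∷ (λ ρ → proj₁ ∨-distrib-∧ _ _ _)
      ∷ (λ ρ → proj₂ ∨-distrib-∧ _ _ _)
      ∷ (λ ρ → proj₁ ∧-distrib-∨ _ _ _)
      ∷ (λ ρ → proj₂ ∧-distrib-∨ _ _ _)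
      ∷ (λ ρ → proj₁ ∨-identity _)
      ∷ (λ ρ → proj₂ ∨-identity _)
      ∷ (λ ρ → proj₁ ∧-identity _)
      ∷ (λ ρ → proj₂ ∧-identity _)
      ∷ (λ ρ → ′-involutive _)
      ∷ (λ ρ → ∨-deMorgan _ _)
      ∷ (λ ρ → ∧-deMorgan _ _)
      ∷ (λ ρ → 𝟎′)
      ∷ (λ ρ → 𝟏′)
      ∷ []
      where open DeMorganProperties A dm

    ⇐ : All (Satisfies A) deMorganAxioms → IsDeMorgan
    ⇐ (∨-comm ∷ ∨-assoc ∷ ∧-comm ∷ ∧-assoc ∷ ∨-absorbs ∷ ∧-absorbs ∷
       ∨-distribˡ ∷ ∨-distribʳ ∷ ∧-distribˡ ∷ ∧-distribʳ ∷
       ∨-idˡ ∷ ∨-idʳ ∷ ∧-idˡ ∷ ∧-idʳ ∷ invol ∷ ∨-dm ∷ ∧-dm ∷ 0′ ∷ 1′ ∷ []) = record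
      { isDistributiveLattice = record
        { isLattice = record
          { isEquivalence = isEquivalence
          ; ∨-comm        = λ x y → ∨-comm (ρ x y y)
          ; ∨-assoc       = λ x y z → ∨-assoc (ρ x y z)
          ; ∨-cong        = λ p q → interp-cong (inj₁ join) (p ∷ q ∷ [])
          ; ∧-comm        = λ x y → ∧-comm (ρ x y y)
          ; ∧-assoc       = λ x y z → ∧-assoc (ρ x y z)
          ; ∧-cong        = λ p q → interp-cong (inj₁ meet) (p ∷ q ∷ [])
          ; absorptive    = (λ x y → ∨-absorbs (ρ x y y)) , (λ x y → ∧-absorbs (ρ x y y))
          }
        ; ∨-distrib-∧ = (λ x y z → ∨-distribˡ (ρ x y z)) , (λ x y z → ∨-distribʳ (ρ x y z))
        ; ∧-distrib-∨ = (λ x y z → ∧-distribˡ (ρ x y z)) , (λ x y z → ∧-distribʳ (ρ x y z))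
        }
      ; ∨-identity   = (λ x → ∨-idˡ (ρ x x x)) , (λ x → ∨-idʳ (ρ x x x))
      ; ∧-identity   = (λ x → ∧-idˡ (ρ x x x)) , (λ x → ∧-idʳ (ρ x x x))
      ; ′-involutive = λ x → invol (ρ x x x)
      ; ∨-deMorgan   = λ x y → ∨-dm (ρ x y y)
      ; ∧-deMorgan   = λ x y → ∧-dm (ρ x y y)
      ; 𝟎′           = 0′ (λ _ → 𝟎)
      ; 𝟏′           = 1′ (λ _ → 𝟎)
      }
      where ρ = valuation A

  regularAxiom : Op₁ (Term (DeMorgan+ X ar)) → Identity (DeMorgan+ X ar)
  regularAxiom _* = (x ∧ᵗ ((x ′ᵗ) *) ′ᵗ) ∨ᵗ (y ∨ᵗ (y *)) , y ∨ᵗ (y *)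
    where x = var 0; y = var 1

module _ {X : Set} where

  starᵗ : X → Op₁ (Term (DeMorgan+ X λ _ → 1))
  starᵗ f t = op (inj₂ f) (t ∷ [])

  -- These identities encode the implication from x ∧ z = 0 to z ≤ x*: if x ∧ z = 0, then z = z ∧ 0*
  -- = z ∧ (x ∧ z)*, and the second identity puts this below x*.
  pseudocomplementAxioms : X → List (Identity (DeMorgan+ X λ _ → 1))
  pseudocomplementAxioms f =
      (x ∧ᵗ x * , 0ᵗ)
    ∷ (z ∧ᵗ (x ∧ᵗ z) * ≤ᵗ x *)
    ∷ (0ᵗ * , 1ᵗ)
    ∷ []
    where
    infix 8 _*
    _* = starᵗ f
    x = var 0; z = var 1

  isPseudocomplement⇔ : ∀ f (A : Algebra (DeMorgan+ X λ _ → 1)) → Reduct.IsDeMorgan A →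
    Reduct.IsPseudocomplement A (λ x → Algebra.interp A (inj₂ f) (x ∷ [])) ⇔
    All (Satisfies A) (pseudocomplementAxioms f)
  isPseudocomplement⇔ f A dm = mk⇔
    (λ psc →
        (λ ρ → proj₁ (psc _))
      ∷ (λ ρ → proj₂ (psc _) _ (≈-trans (≈-sym (∧-assoc _ _ _)) (proj₁ (psc _))))
      ∷ (λ ρ → ≈-trans (≈-sym (proj₁ ∧-identity _)) (≈-sym (proj₂ (psc 𝟎) 𝟏 (proj₂ ∧-identity 𝟎))))
      ∷ [])
    (λ { (∧* ∷ ≤* ∷ 𝟎* ∷ []) x → ∧* (ρ x x x) , λ z x∧z≈𝟎 →
         ≤-trans (≤-reflexive (begin
           z                ≈⟨ proj₂ ∧-identity z ⟨
           z ∧ 𝟏            ≈⟨ ∧-congˡ (𝟎* (λ _ → 𝟎)) ⟨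
           z ∧ 𝟎 *          ≈⟨ ∧-congˡ (interp-cong (inj₂ f) (x∧z≈𝟎 ∷ [])) ⟨
           z ∧ (x ∧ z) *    ∎)) (≤* (ρ x z z)) })
    where
    open Algebra A renaming (refl to ≈-refl; sym to ≈-sym; trans to ≈-trans)
    open Reduct A
    open DeMorganProperties A dm
    open ≈-Reasoning setoid
    ρ = valuation A
    infix 8 _*
    _* : Op₁ Carrier
    x * = interp (inj₂ f) (x ∷ [])

  impᵗ : X → Op₂ (Term (DeMorgan+ X λ _ → 2))
  impᵗ f s t = op (inj₂ f) (s ∷ t ∷ [])

  -- The second identity encodes maximality: when x ∧ z ≤ y, the join (x ∧ z) ∨ y collapses to y,
  -- which leaves z ≤ x → y.
  implicationAxioms : X → List (Identity (DeMorgan+ X λ _ → 2))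
  implicationAxioms f =
      (x ∧ᵗ (x ⇒ y) ≤ᵗ y)
    ∷ (z ≤ᵗ (x ⇒ ((x ∧ᵗ z) ∨ᵗ y)))
    ∷ []
    where
    _⇒_ = impᵗ f
    x = var 0; y = var 1; z = var 2

  isImplication⇔ : ∀ f (A : Algebra (DeMorgan+ X λ _ → 2)) → Reduct.IsDeMorgan A →
    Reduct.IsImplication A (λ x y → Algebra.interp A (inj₂ f) (x ∷ y ∷ [])) ⇔
    All (Satisfies A) (implicationAxioms f)
  isImplication⇔ f A dm = mk⇔
    (λ isImp → (λ ρ → proj₁ (isImp _ _)) ∷ (λ ρ → proj₂ (isImp _ _) _ (x≤x∨y _ _)) ∷ [])
    (λ { (⇒-elim ∷ ⇒-intro ∷ []) x y → ⇒-elim (ρ x y y) , λ z x∧z≤y →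
         ≤-trans (⇒-intro (ρ x y z))
                 (≤-reflexive (interp-cong (inj₂ f) (≈-refl ∷ ≤⇒∨≈ x∧z≤y ∷ []))) })
    where
    open Algebra A renaming (refl to ≈-refl; sym to ≈-sym; trans to ≈-trans)
    open Reduct A
    open DeMorganProperties A dm
    ρ = valuation A

ℝ𝔻𝕄ℙ-isVariety : IsVariety ℝ𝔻𝕄ℙ
ℝ𝔻𝕄ℙ-isVariety = finitelyBased⇒isVariety
  (regularAxiom (starᵗ star) ∷ deMorganAxioms ++ pseudocomplementAxioms star)
  λ A → mk⇔
    (λ r →
        (λ ρ → regular r _ _)
      ∷ ++⁺ (isDeMorgan⇔ A .to (isDeMorgan r))
            (isPseudocomplement⇔ star A (isDeMorgan r) .to (isPseudocomplement r)))
    (λ { (reg ∷ h) →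
      let dm , psc = ++⁻ deMorganAxioms h
          dm = isDeMorgan⇔ A .from dm
      in record
      { isDeMorgan         = dm
      ; isPseudocomplement = isPseudocomplement⇔ star A dm .from psc
      ; regular            = λ x y → reg (valuation A x y y)
      } })
  where open ℝ𝔻𝕄ℙ

ℝ𝔻𝕄ℍ-isVariety : IsVariety ℝ𝔻𝕄ℍ
ℝ𝔻𝕄ℍ-isVariety = finitelyBased⇒isVariety
  (regularAxiom (λ t → impᵗ imp t 0ᵗ) ∷ deMorganAxioms ++ implicationAxioms imp)
  λ A → mk⇔
    (λ r →
        (λ ρ → regular r _ _)
      ∷ ++⁺ (isDeMorgan⇔ A .to (isDeMorgan r))
            (isImplication⇔ imp A (isDeMorgan r) .to (isImplication r)))
    (λ { (reg ∷ h) →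
      let dm , im = ++⁻ deMorganAxioms h
          dm = isDeMorgan⇔ A .from dm
      in record
      { isDeMorgan    = dm
      ; isImplication = isImplication⇔ imp A dm .from im
      ; regular       = λ x y → reg (valuation A x y y)
      } })
  where open ℝ𝔻𝕄ℍ

ℝ𝔻𝕄𝔻𝔹𝕃ℍ-isVariety : IsVariety ℝ𝔻𝕄𝔻𝔹𝕃ℍ
ℝ𝔻𝕄𝔻𝔹𝕃ℍ-isVariety = finitelyBased⇒isVariety
  ( regularAxiom (λ t → impᵗ imp t 0ᵗ)
  ∷ (impᵗ coimp x y , impᵗ imp (x ′ᵗ) (y ′ᵗ) ′ᵗ)
  ∷ deMorganAxioms ++ implicationAxioms imp)
  λ A → mk⇔
    (λ r →
        (λ ρ → regular r _ _)
      ∷ (λ ρ → dualImplication⇔ A (isDeMorgan r) {_⇒_ r} {_⇐_ r} (isImplication r) .to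
                 (isDualImplication r) _ _)
      ∷ ++⁺ (isDeMorgan⇔ A .to (isDeMorgan r))
            (isImplication⇔ imp A (isDeMorgan r) .to (isImplication r)))
    (λ { (reg ∷ dual ∷ h) →
      let dm , im = ++⁻ deMorganAxioms h
          dm = isDeMorgan⇔ A .from dm
          im = isImplication⇔ imp A dm .from im
      in record
      { isDeMorgan        = dm
      ; isImplication     = im
      ; isDualImplication = dualImplication⇔ A dm im .from λ x y → dual (valuation A x y y)
      ; regular           = λ x y → reg (valuation A x y y)
      } })
  where
  open ℝ𝔻𝕄𝔻𝔹𝕃ℍ
  open DeMorganProperties using (dualImplication⇔)
  x = var 0; y = var 1

ℝ𝔻𝕄𝔻𝔹𝕃ℙ-isVariety : IsVariety ℝ𝔻𝕄𝔻𝔹𝕃ℙ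
ℝ𝔻𝕄𝔻𝔹𝕃ℙ-isVariety = finitelyBased⇒isVariety
  ( regularAxiom (starᵗ star)
  ∷ (starᵗ plus x , starᵗ star (x ′ᵗ) ′ᵗ)
  ∷ deMorganAxioms ++ pseudocomplementAxioms star)
  λ A → mk⇔
    (λ r →
        (λ ρ → regular r _ _)
      ∷ (λ ρ → dualPseudocomplement⇔ A (isDeMorgan r) {_* r} {_⁺ r} (isPseudocomplement r) .to
                 (isDualPseudocomplement r) _)
      ∷ ++⁺ (isDeMorgan⇔ A .to (isDeMorgan r))
            (isPseudocomplement⇔ star A (isDeMorgan r) .to (isPseudocomplement r)))
    (λ { (reg ∷ dual ∷ h) →
      let dm , psc = ++⁻ deMorganAxioms h
          dm = isDeMorgan⇔ A .from dm
          psc = isPseudocomplement⇔ star A dm .from psc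
      in record
      { isDeMorgan             = dm
      ; isPseudocomplement     = psc
      ; isDualPseudocomplement = dualPseudocomplement⇔ A dm psc .from
                                   λ x → dual (valuation A x x x)
      ; regular                = λ x y → reg (valuation A x y y)
      } })
  where
  open ℝ𝔻𝕄𝔻𝔹𝕃ℙ
  open DeMorganProperties using (dualPseudocomplement⇔)
  x = var 0

-- Graphs, their doubles and the De Morgan algebra of down-sets.

T-not : ∀ {b} → T (not b) ⇔ (¬ T b)
T-not {false} = mk⇔ (λ _ ()) (λ _ → tt)
T-not {true}  = mk⇔ (λ ()) (λ ¬⊤ → ¬⊤ tt)

-- Loops are allowed, and their absence is what the identities will detect. The field `neighbour`
-- puts a low point below every high point of the double, so that a nonempty down-set contains a low
-- point.
record Graph : Set₁ where
  infix 4 _~_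
  field
    Vertex    : Set
    _~_       : Vertex → Vertex → Set
    ~-sym     : Symmetric _~_
    neighbour : ∀ v → ∃ (v ~_)

  infixr 5 _∷_

  -- Walks with at most k steps.
  data Walk : ℕ → Vertex → Vertex → Set where
    []  : ∀ {k v} → Walk k v v
    _∷_ : ∀ {k u v w} → u ~ v → Walk k v w → Walk (ℕ.suc k) u w

  walk-mono : ∀ {k l u v} → k Nat.≤ l → Walk k u v → Walk l u v
  walk-mono k≤l       []      = []
  walk-mono (s≤s k≤l) (e ∷ p) = e ∷ walk-mono k≤l p

module Double (G : Graph) where
  open Graph G public

  data Point : Set where
    low high : Vertex → Point

  infix 4 _⊑_

  data _⊑_ : Point → Point → Set where
    ⊑-refl : ∀ {x} → x ⊑ x
    edge   : ∀ {u v} → u ~ v → low u ⊑ high v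

  ⊑-trans : ∀ {x y z} → x ⊑ y → y ⊑ z → x ⊑ z
  ⊑-trans ⊑-refl   y⊑z    = y⊑z
  ⊑-trans (edge e) ⊑-refl = edge e

  flip : Point → Point
  flip (low v)  = high v
  flip (high v) = low v

  flip-involutive : ∀ x → flip (flip x) ≡ x
  flip-involutive (low v)  = refl
  flip-involutive (high v) = refl

  flip-antitone : ∀ {x y} → x ⊑ y → flip y ⊑ flip x
  flip-antitone ⊑-refl   = ⊑-refl
  flip-antitone (edge e) = edge (~-sym e)

  -- The poset has no chain of three points, so one of the two comparisons is an equality. The
  -- regularity identity rests on this.
  height≤1 : ∀ {x y z} → y ⊑ x → x ⊑ z → x ⊑ y ⊎ z ⊑ x
  height≤1 ⊑-refl   x⊑z    = inj₁ ⊑-refl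
  height≤1 (edge e) ⊑-refl = inj₂ ⊑-refl

  -- Boolean membership keeps the carrier in `Set`, as `Algebra` demands, and reduces the De Morgan
  -- laws to laws of `Bool`.
  record DownSet : Set where
    constructor downSet
    field
      member : Point → Bool
      closed : ∀ {x y} → x ⊑ y → T (member y) → T (member x)

  open DownSet public

  infix 4 _∋_

  _∋_ : DownSet → Point → Set
  a ∋ x = T (member a x)

  downSets : Setoid 0ℓ 0ℓ
  downSets = On.setoid (Point →-setoid Bool) member

  open Setoid downSets public using (_≈_)

  infixr 6 _∪_
  infixr 7 _∩_
  infix  8 ∁_

  _∪_ _∩_ : Op₂ DownSet
  (a ∪ b) .member x   = member a x Bool.∨ member b x
  (a ∪ b) .closed x⊑y = T-∨ .from ∘ Sum.map (closed a x⊑y) (closed b x⊑y) ∘ T-∨ .to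
  (a ∩ b) .member x   = member a x Bool.∧ member b x
  (a ∩ b) .closed x⊑y = T-∧ .from ∘ Product.map (closed a x⊑y) (closed b x⊑y) ∘ T-∧ .to

  -- The complement of a down-set is an up-set; the antitone `flip` turns it back into a down-set.
  ∁_ : Op₁ DownSet
  (∁ a) .member x   = not (member a (flip x))
  (∁ a) .closed x⊑y = T-not .from ∘ (λ ∉a → ∉a ∘ closed a (flip-antitone x⊑y)) ∘ T-not .to

  ∅ U : DownSet
  ∅ = downSet (λ _ → false) (λ _ → id)
  U = downSet (λ _ → true) (λ _ → id)

  module _ {X : Set} {ar : X → ℕ} (ops : ∀ f → Vec DownSet (ar f) → DownSet)
           (ops-cong : ∀ f {as bs} → Pointwise _≈_ as bs → ops f as ≈ ops f bs) where

    -- The further operations are parameters, so that one De Morgan reduct serves all four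
    -- signatures.
    expansion : Algebra (DeMorgan+ X ar)
    expansion = record
      { setoid = downSets
      ; interp = λ
        { (inj₁ join) (a ∷ b ∷ []) → a ∪ b
        ; (inj₁ meet) (a ∷ b ∷ []) → a ∩ b
        ; (inj₁ neg)  (a ∷ [])     → ∁ a
        ; (inj₁ bot)  []           → ∅
        ; (inj₁ top)  []           → U
        ; (inj₂ f)    as           → ops f as
        }
      ; interp-cong = λ
        { (inj₁ join) (p ∷ q ∷ []) x → cong₂ Bool._∨_ (p x) (q x)
        ; (inj₁ meet) (p ∷ q ∷ []) x → cong₂ Bool._∧_ (p x) (q x)
        ; (inj₁ neg)  (p ∷ [])     x → cong not (p (flip x))
        ; (inj₁ bot)  []           x → refl
        ; (inj₁ top)  []           x → refl
        ; (inj₂ f)    ps             → ops-cong f ps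
        }
      }

    open Reduct expansion

    expansion-isDeMorgan : IsDeMorgan
    expansion-isDeMorgan = record
      { isDistributiveLattice = record
        { isLattice = record
          { isEquivalence = Setoid.isEquivalence downSets
          ; ∨-comm        = λ a b x → Bool.∨-comm (member a x) _
          ; ∨-assoc       = λ a b c x → Bool.∨-assoc (member a x) _ _
          ; ∨-cong        = λ p q x → cong₂ Bool._∨_ (p x) (q x)
          ; ∧-comm        = λ a b x → Bool.∧-comm (member a x) _
          ; ∧-assoc       = λ a b c x → Bool.∧-assoc (member a x) _ _
          ; ∧-cong        = λ p q x → cong₂ Bool._∧_ (p x) (q x)
          ; absorptive    = (λ a b x → proj₁ Bool.∨-∧-absorptive (member a x) (member b x))
                          , (λ a b x → proj₂ Bool.∨-∧-absorptive (member a x) (member b x))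
          }
        ; ∨-distrib-∧ = (λ a b c x → Bool.∨-distribˡ-∧ (member a x) _ _)
                      , (λ a b c x → Bool.∨-distribʳ-∧ (member a x) (member b x) (member c x))
        ; ∧-distrib-∨ = (λ a b c x → Bool.∧-distribˡ-∨ (member a x) _ _)
                      , (λ a b c x → Bool.∧-distribʳ-∨ (member a x) (member b x) (member c x))
        }
      ; ∨-identity   = (λ a x → refl) , (λ a x → Bool.∨-identityʳ _)
      ; ∧-identity   = (λ a x → refl) , (λ a x → Bool.∧-identityʳ _)
      ; ′-involutive = λ a x → trans (not-involutive _) (cong (member a) (flip-involutive x))
      ; ∨-deMorgan   = λ a b x → deMorgan₂ (member a (flip x)) _
      ; ∧-deMorgan   = λ a b x → deMorgan₁ (member a (flip x)) _
      ; 𝟎′           = λ x → refl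
      ; 𝟏′           = λ x → refl
      }
      where open import Algebra.Lattice.Properties.BooleanAlgebra Bool.∨-∧-booleanAlgebra
              using (deMorgan₁; deMorgan₂)

    ⊆⇒≤ : ∀ {a b} → (∀ x → a ∋ x → b ∋ x) → a ≤ b
    ⊆⇒≤ a⊆b x = T-ext (λ a∋x → T-∧ .from (a∋x , a⊆b x a∋x)) (proj₁ ∘ T-∧ .to)

    ≤⇒⊆ : ∀ {a b} → a ≤ b → ∀ x → a ∋ x → b ∋ x
    ≤⇒⊆ a≤b x = proj₂ ∘ T-∧ .to ∘ subst T (a≤b x)

  -- Implication, regularity and the modal logic of the graph.

  module Heyting (em : ExcludedMiddle 0ℓ) where

    private
      implies? : ∀ a b x → Dec (∀ y → y ⊑ x → a ∋ y → b ∋ y)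
      implies? a b x = em

    infixr 5 _⇒_

    _⇒_ : Op₂ DownSet
    (a ⇒ b) .member x   = ⌊ implies? a b x ⌋
    (a ⇒ b) .closed x⊑y h = fromWitness λ z z⊑x → toWitness h z (⊑-trans z⊑x x⊑y)

    ⇒∋ : ∀ a b x → (a ⇒ b) ∋ x ⇔ (∀ y → y ⊑ x → a ∋ y → b ∋ y)
    ⇒∋ a b x = mk⇔ toWitness fromWitness

    ⇒-cong : ∀ {a a′ b b′} → a ≈ a′ → b ≈ b′ → (a ⇒ b) ≈ (a′ ⇒ b′)
    ⇒-cong {a} {a′} {b} {b′} a≈a′ b≈b′ x = T-ext
      (λ h → ⇒∋ a′ b′ x .from λ y y⊑x →
         subst T (b≈b′ y) ∘ ⇒∋ a b x .to h y y⊑x ∘ subst T (sym (a≈a′ y)))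
      (λ h → ⇒∋ a b x .from λ y y⊑x →
         subst T (sym (b≈b′ y)) ∘ ⇒∋ a′ b′ x .to h y y⊑x ∘ subst T (a≈a′ y))

    infix 9 _*

    _* : Op₁ DownSet
    a * = a ⇒ ∅

    -- A low point is minimal, so the condition over all points below it concerns that point alone.
    *∋low : ∀ a v → a * ∋ low v ⇔ (¬ (a ∋ low v))
    *∋low a v = mk⇔ (λ h → ⇒∋ a ∅ (low v) .to h (low v) ⊑-refl)
                    (λ ∌v → ⇒∋ a ∅ (low v) .from λ { _ ⊑-refl → ∌v })

    module _ {X : Set} {ar : X → ℕ} (ops : ∀ f → Vec DownSet (ar f) → DownSet)
             (ops-cong : ∀ f {as bs} → Pointwise _≈_ as bs → ops f as ≈ ops f bs) where

      open Reduct (expansion ops ops-cong)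

      ⇒-isImplication : IsImplication _⇒_
      ⇒-isImplication a b =
          ⊆⇒≤ ops ops-cong {a ∩ (a ⇒ b)} {b} (λ x h →
            let a∋x , h = T-∧ .to h in ⇒∋ a b x .to h x ⊑-refl a∋x)
        , λ c a∩c≤b → ⊆⇒≤ ops ops-cong {c} {a ⇒ b} λ x c∋x →
            ⇒∋ a b x .from λ y y⊑x a∋y →
              ≤⇒⊆ ops ops-cong {a ∩ c} {b} a∩c≤b y (T-∧ .from (a∋y , closed c y⊑x c∋x))

      -- A point of a ∩ ∁ ((∁ a) *) has a point strictly above it, so it is minimal.
      *-regular : Regular _*
      *-regular a b x = T-ext
        (λ h → [ minimal , id ]′ (T-∨ {member (a ∩ ∁ ((∁ a) *)) x} .to h))
        (T-∨ {member (a ∩ ∁ ((∁ a) *)) x} .from ∘ inj₂)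
        where
        minimal : a ∩ ∁ ((∁ a) *) ∋ x → b ∪ b * ∋ x
        minimal h with T-∧ .to h
        ... | a∋x , h with em {b ∋ x}
        ...   | yes b∋x = T-∨ .from (inj₁ b∋x)
        ...   | no b∌x  = T-∨ .from (inj₂ (⇒∋ b ∅ x .from λ y y⊑x b∋y →
          T-not .to h (⇒∋ (∁ a) ∅ (flip x) .from λ z z⊑x′ ∁a∋z →
            [ (λ x⊑y → b∌x (closed b x⊑y b∋y))
            , (λ z′⊑x → T-not .to ∁a∋z (closed a z′⊑x a∋x))
            ]′ (height≤1 y⊑x (subst (_⊑ flip z) (flip-involutive x) (flip-antitone z⊑x′))))))

    none : Op₁ DownSet
    none a = (∁ (a *)) *

    -- At `low v` the outer `_*` is negation, and `∁_` moves the question to `high v`, so the left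
    -- side says that `a *` contains `high v`. The points below `high v` are itself and the low
    -- copies of the neighbours of `v`.
    none∋low : ∀ a v → none a ∋ low v ⇔ (∀ u → v ~ u → ¬ (a ∋ low u))
    none∋low a v = mk⇔
      (λ h u v~u → ⇒∋ a ∅ (high v) .to (¬T-not⇒T (*∋low (∁ (a *)) v .to h))
                     (low u) (edge (~-sym v~u)))
      (λ ∌ → *∋low (∁ (a *)) v .from λ h → T-not .to h (⇒∋ a ∅ (high v) .from (below ∌)))
      where
      ¬T-not⇒T : ∀ {b} → ¬ T (not b) → T b
      ¬T-not⇒T = subst T (not-involutive _) ∘ T-not .from

      below : (∀ u → v ~ u → ¬ (a ∋ low u)) → ∀ y → y ⊑ high v → ¬ (a ∋ y)
      below ∌ _ (edge u~v) a∋u = ∌ _ (~-sym u~v) a∋u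
      -- If `a` contained `high v`, closure would put the low copy of some neighbour in `a`; one
      -- exists since no vertex is isolated.
      below ∌ _ ⊑-refl a∋v     =
        let u , v~u = neighbour v in ∌ u v~u (closed a (edge (~-sym v~u)) a∋v)

    -- This is the diamond modality of the graph, obtained as the negation of `none`; the forward
    -- direction is classical.
    none*∋low : ∀ a v → (none a) * ∋ low v ⇔ (∃ λ u → v ~ u × a ∋ low u)
    none*∋low a v = mk⇔ forth λ (u , v~u , a∋u) → *∋low (none a) v .from λ h →
      none∋low a v .to h u v~u a∋u
      where
      forth : (none a) * ∋ low v → ∃ λ u → v ~ u × a ∋ low u
      forth h with em {∃ λ u → v ~ u × a ∋ low u}
      ... | yes p = p
      ... | no ¬p = contradiction
        (none∋low a v .from λ u v~u a∋u → ¬p (u , v~u , a∋u)) (*∋low (none a) v .to h)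

    reach : ℕ → Op₁ DownSet
    reach zero      a = a
    reach (ℕ.suc k) a = a ∪ (none (reach k a)) *

    reach∋low : ∀ k a v → reach k a ∋ low v ⇔ (∃ λ u → Walk k v u × a ∋ low u)
    reach∋low zero a v = mk⇔ (λ a∋v → v , [] , a∋v) λ { (_ , [] , a∋v) → a∋v }
    reach∋low (ℕ.suc k) a v = mk⇔
      (λ h → [ (λ a∋v → v , [] , a∋v)
             , (λ h → let w , v~w , r∋w = none*∋low (reach k a) v .to h
                          u , p , a∋u = reach∋low k a w .to r∋w
                      in u , v~w ∷ p , a∋u)
             ]′ (T-∨ .to h))
      λ { (_ , [] , a∋v)      → T-∨ .from (inj₁ a∋v)
        ; (u , v~w ∷ p , a∋u) → T-∨ {member a (low v)} .from (inj₂
            (none*∋low (reach k a) v .from (_ , v~w , reach∋low k a _ .from (u , p , a∋u)))) }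

    -- Terms cannot speak of loops directly. A vertex of `a` without neighbours in `a` cannot be its
    -- own neighbour, and for a loopless `v` the singleton `⟨ v ⟩` realises the condition at `v`.
    loopless : Op₁ DownSet
    loopless a = a ∩ none a

    loopless∋⇒≁ : ∀ a v → loopless a ∋ low v → ¬ (v ~ v)
    loopless∋⇒≁ a v h v~v =
      let a∋v , h = T-∧ .to h in none∋low a v .to h v v~v a∋v

    -- The modal formula for two loopless vertices at distance exactly `k` + 1, where `a` and `b`
    -- act as propositional variables marking the two.
    apart : ℕ → Op₂ DownSet
    apart k a b = loopless a ∩ (reach (ℕ.suc k) (loopless b) ∩ (reach k b) *)

    private
      _≟_ : ∀ (u v : Vertex) → Dec (u ≡ v)
      u ≟ v = em

    ⟨_⟩ : Vertex → DownSet
    ⟨ v ⟩ .member (low u)  = ⌊ u ≟ v ⌋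
    ⟨ v ⟩ .member (high u) = false
    ⟨ v ⟩ .closed ⊑-refl   = id
    ⟨ v ⟩ .closed (edge e) ()

    ⟨⟩∋low : ∀ u v → ⟨ v ⟩ ∋ low u ⇔ u ≡ v
    ⟨⟩∋low u v = mk⇔ toWitness fromWitness

    loopless⟨⟩ : ∀ v → ¬ (v ~ v) → loopless ⟨ v ⟩ ∋ low v
    loopless⟨⟩ v v≁v = T-∧ .from
      ( ⟨⟩∋low v v .from refl
      , none∋low ⟨ v ⟩ v .from λ u v~u ∋u → v≁v (subst (v ~_) (⟨⟩∋low u v .to ∋u) v~u))

    -- Every high point has a low point below it. This confines an equation with `∅` to the low
    -- points, where the modal reading applies.
    no-low⇒≈∅ : ∀ a → (∀ v → ¬ (a ∋ low v)) → a ≈ ∅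
    no-low⇒≈∅ a ∌ x = T-ext (∌-everywhere x) λ ()
      where
      ∌-everywhere : ∀ x → ¬ (a ∋ x)
      ∌-everywhere (low v)  = ∌ v
      ∌-everywhere (high v) a∋v =
        let u , v~u = neighbour v in ∌ u (closed a (edge (~-sym v~u)) a∋v)

    -- A frame correspondence: a pair that admits no shortening makes the formula true at `low v`
    -- under the valuation by `⟨ v ⟩` and `⟨ u ⟩`; conversely, a low point satisfying the formula
    -- yields a loopless pair whose walk, once shortened, contradicts the last conjunct.
    apart≈∅⇔ : ∀ k → (∀ a b → apart k a b ≈ ∅) ⇔
                     (∀ v u → ¬ (v ~ v) → ¬ (u ~ u) → Walk (ℕ.suc k) v u → Walk k v u)
    apart≈∅⇔ k = mk⇔ forth back
      where
      forth : (∀ a b → apart k a b ≈ ∅) →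
              ∀ v u → ¬ (v ~ v) → ¬ (u ~ u) → Walk (ℕ.suc k) v u → Walk k v u
      forth empty v u v≁v u≁u p with em {Walk k v u}
      ... | yes q = q
      ... | no ¬q = contradiction
        (T-∧ .from (loopless⟨⟩ v v≁v , T-∧ .from
          ( reach∋low (ℕ.suc k) (loopless ⟨ u ⟩) v .from (u , p , loopless⟨⟩ u u≁u)
          , *∋low (reach k ⟨ u ⟩) v .from λ h →
              let w , q , w≡u = reach∋low k ⟨ u ⟩ v .to h
              in ¬q (subst (Walk k v) (⟨⟩∋low w u .to w≡u) q))))
        (subst T (empty ⟨ v ⟩ ⟨ u ⟩ (low v)))

      back : (∀ v u → ¬ (v ~ v) → ¬ (u ~ u) → Walk (ℕ.suc k) v u → Walk k v u) →
             ∀ a b → apart k a b ≈ ∅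
      back shorten a b = no-low⇒≈∅ (apart k a b) λ v h →
        let la∋v , h     = T-∧ .to h
            r∋v , r*∋v   = T-∧ .to h
            u , p , lb∋u = reach∋low (ℕ.suc k) (loopless b) v .to r∋v
            q = shorten v u (loopless∋⇒≁ a v la∋v) (loopless∋⇒≁ b u lb∋u) p
        in *∋low (reach k b) v .to r*∋v
             (reach∋low k b v .from (u , q , proj₁ (T-∧ .to lb∋u)))

-- The modal formulas as terms.

module _ {X : Set} {ar : X → ℕ} (starᵗ : Op₁ (Term (DeMorgan+ X ar))) where

  noneᵗ : Op₁ (Term (DeMorgan+ X ar))
  noneᵗ t = starᵗ (starᵗ t ′ᵗ)

  reachᵗ : ℕ → Op₁ (Term (DeMorgan+ X ar))
  reachᵗ zero      t = t
  reachᵗ (ℕ.suc k) t = t ∨ᵗ starᵗ (noneᵗ (reachᵗ k t))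

  looplessᵗ : Op₁ (Term (DeMorgan+ X ar))
  looplessᵗ t = t ∧ᵗ noneᵗ t

  apartᵗ : ℕ → Term (DeMorgan+ X ar)
  apartᵗ k = looplessᵗ p ∧ᵗ (reachᵗ (ℕ.suc k) (looplessᵗ q) ∧ᵗ starᵗ (reachᵗ k q))
    where p = var 0; q = var 1

  apartIdentity : ℕ → Identity (DeMorgan+ X ar)
  apartIdentity k = apartᵗ k , 0ᵗ

  module _ (em : ExcludedMiddle 0ℓ) (G : Graph) where
    open Double G
    open Heyting em

    module _ (ops : ∀ f → Vec DownSet (ar f) → DownSet)
             (ops-cong : ∀ f {as bs} → Pointwise _≈_ as bs → ops f as ≈ ops f bs)
             (eval-star : ∀ ρ t → eval (expansion ops ops-cong) ρ (starᵗ t) ≡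
                                  eval (expansion ops ops-cong) ρ t *) where
      private
        E : Algebra (DeMorgan+ X ar)
        E = expansion ops ops-cong

        eval-none : ∀ ρ t → eval E ρ (noneᵗ t) ≡ none (eval E ρ t)
        eval-none ρ t = trans (eval-star ρ _) (cong (λ a → (∁ a) *) (eval-star ρ t))

        eval-reach : ∀ ρ k t → eval E ρ (reachᵗ k t) ≡ reach k (eval E ρ t)
        eval-reach ρ zero      t = refl
        eval-reach ρ (ℕ.suc k) t = cong (eval E ρ t ∪_)
          (trans (eval-star ρ _)
                 (cong _* (trans (eval-none ρ (reachᵗ k t)) (cong none (eval-reach ρ k t)))))

        eval-loopless : ∀ ρ t → eval E ρ (looplessᵗ t) ≡ loopless (eval E ρ t)
        eval-loopless ρ t = cong (eval E ρ t ∩_) (eval-none ρ t)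

        eval-apart : ∀ ρ k → eval E ρ (apartᵗ k) ≡ apart k (ρ 0) (ρ 1)
        eval-apart ρ k = cong₂ _∩_ (eval-loopless ρ (var 0)) (cong₂ _∩_
          (trans (eval-reach ρ (ℕ.suc k) (looplessᵗ (var 1)))
                 (cong (reach (ℕ.suc k)) (eval-loopless ρ (var 1))))
          (trans (eval-star ρ (reachᵗ k (var 1))) (cong _* (eval-reach ρ k (var 1)))))

      -- Evaluation commutes with the translation, so the frame correspondence applies. The term
      -- operation `starᵗ` is a parameter because the pseudocomplement is basic in two signatures
      -- and x → 0 in the other two.
      apartIdentity⇔ : ∀ k → Satisfies E (apartIdentity k) ⇔
        (∀ v u → ¬ (v ~ v) → ¬ (u ~ u) → Walk (ℕ.suc k) v u → Walk k v u)
      apartIdentity⇔ k = mk⇔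
        (λ sat → apart≈∅⇔ k .to λ a b → subst (_≈ ∅) (eval-apart (val a b) k) (sat (val a b)))
        (λ h ρ → subst (_≈ ∅) (sym (eval-apart ρ k)) (apart≈∅⇔ k .from h (ρ 0) (ρ 1)))
        where val = λ a b → valuation E a b b

-- Paths with two loopless vertices.

-- The path continues past `n` + 1, so every vertex has its successor as a neighbour. The additional
-- vertices carry loops and hence are never endpoints in the correspondence.
data Link (n : ℕ) : ℕ → ℕ → Set where
  up   : ∀ {i} → Link n i (ℕ.suc i)
  down : ∀ {i} → Link n (ℕ.suc i) i
  loop : ∀ {i} → i ≢ 0 → i ≢ ℕ.suc n → Link n i i

chain : ℕ → Graph
chain n = record
  { Vertex    = ℕ
  ; _~_       = Link n
  ; ~-sym     = λ { up → down; down → up; (loop p q) → loop p q }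
  ; neighbour = λ i → ℕ.suc i , up
  }

module Chain (n : ℕ) where
  open Double (chain n) public

  loopless⇒end : ∀ i → ¬ (i ~ i) → i ≡ 0 ⊎ i ≡ ℕ.suc n
  loopless⇒end i i≁i with i Nat.≟ 0 | i Nat.≟ ℕ.suc n
  ... | yes p | _     = inj₁ p
  ... | no _  | yes q = inj₂ q
  ... | no p  | no q  = contradiction (loop p q) i≁i

  left-loopless : ¬ (0 ~ 0)
  left-loopless (loop p _) = p refl

  right-loopless : ¬ (ℕ.suc n ~ ℕ.suc n)
  right-loopless (loop _ q) = q refl

  -- An edge changes the vertex by at most 1. Two inequalities express the bound without truncated
  -- subtraction.
  walk-bound : ∀ {k i j} → Walk k i j → i Nat.≤ k Nat.+ j × j Nat.≤ k Nat.+ i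
  walk-bound {k} []          = Nat.m≤n+m _ k , Nat.m≤n+m _ k
  walk-bound {ℕ.suc k} (e ∷ p) = let i≤ , ≤i = walk-bound p in
    Nat.≤-trans (proj₁ (link-bound e)) (s≤s i≤)
    , Nat.≤-trans ≤i (Nat.≤-trans (Nat.+-monoʳ-≤ k (proj₂ (link-bound e)))
                                  (Nat.≤-reflexive (Nat.+-suc k _)))
    where
    link-bound : ∀ {i j} → i ~ j → i Nat.≤ ℕ.suc j × j Nat.≤ ℕ.suc i
    link-bound up         = Nat.m≤n⇒m≤1+n (Nat.n≤1+n _) , Nat.≤-refl
    link-bound down       = Nat.≤-refl , Nat.m≤n⇒m≤1+n (Nat.n≤1+n _)
    link-bound (loop _ _) = Nat.n≤1+n _ , Nat.n≤1+n _

  climb : ∀ k i → Walk k i (k Nat.+ i)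
  climb zero      i = []
  climb (ℕ.suc k) i = up ∷ subst (Walk k (ℕ.suc i)) (Nat.+-suc k i) (climb k (ℕ.suc i))

  descend : ∀ k → Walk k k 0
  descend zero      = []
  descend (ℕ.suc k) = down ∷ descend k

  ends-joined : Walk (ℕ.suc n) 0 (ℕ.suc n)
  ends-joined = subst (Walk (ℕ.suc n) 0) (Nat.+-identityʳ _) (climb (ℕ.suc n) 0)

  -- The loopless vertices 0 and `n` + 1 lie at distance `n` + 1. For `k` = `n` the walk joining
  -- them cannot be shortened. Otherwise a walk of at most `k` + 1 steps between distinct ends
  -- forces `n` < `k`, and the direct walk fits.
  shorten⇔ : ∀ k → (∀ v u → ¬ (v ~ v) → ¬ (u ~ u) → Walk (ℕ.suc k) v u → Walk k v u) ⇔ n ≢ k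
  shorten⇔ k = mk⇔ ⇒ ⇐
    where
    ⇒ : (∀ v u → ¬ (v ~ v) → ¬ (u ~ u) → Walk (ℕ.suc k) v u → Walk k v u) → n ≢ k
    ⇒ shorten refl = Nat.1+n≰n (subst (ℕ.suc n Nat.≤_) (Nat.+-identityʳ n)
      (proj₂ (walk-bound (shorten 0 (ℕ.suc n) left-loopless right-loopless ends-joined))))

    -- The hypothesis is what `walk-bound` gives when one end is 0.
    <k : n ≢ k → ℕ.suc n Nat.≤ ℕ.suc k Nat.+ 0 → ℕ.suc n Nat.≤ k
    <k n≢k h = Nat.≤∧≢⇒< (Nat.s≤s⁻¹ (subst (ℕ.suc n Nat.≤_) (Nat.+-identityʳ _) h)) n≢k

    ⇐ : n ≢ k → ∀ v u → ¬ (v ~ v) → ¬ (u ~ u) → Walk (ℕ.suc k) v u → Walk k v u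
    ⇐ n≢k v u v≁v u≁u p with loopless⇒end v v≁v | loopless⇒end u u≁u
    ... | inj₁ refl | inj₁ refl = []
    ... | inj₂ refl | inj₂ refl = []
    ... | inj₁ refl | inj₂ refl = walk-mono (<k n≢k (proj₂ (walk-bound p))) ends-joined
    ... | inj₂ refl | inj₁ refl = walk-mono (<k n≢k (proj₁ (walk-bound p))) (descend (ℕ.suc n))

-- Countability of the operation symbols.

Countable-⊎ : ∀ {A B} → Countable A → Countable B → Countable (A ⊎ B)
Countable-⊎ (f , f-inj) (g , g-inj) = [ pair 0 ∘ f , pair 1 ∘ g ]′ , λ {x} {y} → injective x y
  where
  injective : ∀ x y → [ pair 0 ∘ f , pair 1 ∘ g ]′ x ≡ [ pair 0 ∘ f , pair 1 ∘ g ]′ y → x ≡ y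
  injective (inj₁ x) (inj₁ y) eq = cong inj₁ (f-inj (proj₂ (pair-injective eq)))
  injective (inj₁ x) (inj₂ y) eq with () ← proj₁ (pair-injective eq)
  injective (inj₂ x) (inj₁ y) eq with () ← proj₁ (pair-injective eq)
  injective (inj₂ x) (inj₂ y) eq = cong inj₂ (g-inj (proj₂ (pair-injective eq)))

retraction⇒Countable : ∀ {A} (code : A → ℕ) (decode : ℕ → A) → (∀ x → decode (code x) ≡ x) →
                       Countable A
retraction⇒Countable code decode inverse =
  code , λ eq → trans (sym (inverse _)) (trans (cong decode eq) (inverse _))

DMOp-countable : Countable DMOp
DMOp-countable = retraction⇒Countable
  (λ { join → 0; meet → 1; neg → 2; bot → 3; top → 4 })
  (λ { 0 → join; 1 → meet; 2 → neg; 3 → bot; _ → top })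
  (λ { join → refl; meet → refl; neg → refl; bot → refl; top → refl })

POp-countable : Countable POp
POp-countable = retraction⇒Countable (λ _ → 0) (λ _ → star) λ { star → refl }

HOp-countable : Countable HOp
HOp-countable = retraction⇒Countable (λ _ → 0) (λ _ → imp) λ { imp → refl }

DblHOp-countable : Countable DblHOp
DblHOp-countable = retraction⇒Countable
  (λ { imp → 0; coimp → 1 }) (λ { 0 → imp; _ → coimp }) λ { imp → refl; coimp → refl }

DblPOp-countable : Countable DblPOp
DblPOp-countable = retraction⇒Countable
  (λ { star → 0; plus → 1 }) (λ { 0 → star; _ → plus }) λ { star → refl; plus → refl }

-- The separating algebras in the four signatures.

module _ (em : ExcludedMiddle (suc 0ℓ)) where

  private
    em₀ : ExcludedMiddle 0ℓ
    em₀ = ExcludedMiddle-lower 0ℓ (suc 0ℓ) em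

  module ChainExpansions (n : ℕ) where
    open Chain n public
    open Heyting em₀ public

    pOps : POp → Vec DownSet 1 → DownSet
    pOps star (a ∷ []) = a *

    pOps-cong : ∀ f {as bs} → Pointwise _≈_ as bs → pOps f as ≈ pOps f bs
    pOps-cong star {a ∷ []} {b ∷ []} (p ∷ []) = ⇒-cong {a} {b} {∅} {∅} p (λ _ → refl)

    hOps : HOp → Vec DownSet 2 → DownSet
    hOps imp (a ∷ b ∷ []) = a ⇒ b

    hOps-cong : ∀ f {as bs} → Pointwise _≈_ as bs → hOps f as ≈ hOps f bs
    hOps-cong imp {a ∷ b ∷ []} {a′ ∷ b′ ∷ []} (p ∷ q ∷ []) = ⇒-cong {a} {a′} {b} {b′} p q

    -- The dual operation is written as a conjugate under `∁_`, which is definitionally the form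
    -- handled by `implication⇒dualImplication`.
    dblHOps : DblHOp → Vec DownSet 2 → DownSet
    dblHOps imp   (a ∷ b ∷ []) = a ⇒ b
    dblHOps coimp (a ∷ b ∷ []) = ∁ (∁ a ⇒ ∁ b)

    dblHOps-cong : ∀ f {as bs} → Pointwise _≈_ as bs → dblHOps f as ≈ dblHOps f bs
    dblHOps-cong imp   {a ∷ b ∷ []} {a′ ∷ b′ ∷ []} (p ∷ q ∷ []) = ⇒-cong {a} {a′} {b} {b′} p q
    dblHOps-cong coimp {a ∷ b ∷ []} {a′ ∷ b′ ∷ []} (p ∷ q ∷ []) x =
      cong not (⇒-cong {∁ a} {∁ a′} {∁ b} {∁ b′}
                       (cong not ∘ p ∘ flip) (cong not ∘ q ∘ flip) (flip x))

    dblPOps : DblPOp → Vec DownSet 1 → DownSet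
    dblPOps star (a ∷ []) = a *
    dblPOps plus (a ∷ []) = ∁ ((∁ a) *)

    dblPOps-cong : ∀ f {as bs} → Pointwise _≈_ as bs → dblPOps f as ≈ dblPOps f bs
    dblPOps-cong star {a ∷ []} {b ∷ []} (p ∷ []) = ⇒-cong {a} {b} {∅} {∅} p (λ _ → refl)
    dblPOps-cong plus {a ∷ []} {b ∷ []} (p ∷ []) x =
      cong not (⇒-cong {∁ a} {∁ b} {∅} {∅} (cong not ∘ p ∘ flip) (λ _ → refl) (flip x))

  open ChainExpansions

  ℝ𝔻𝕄ℙ≃2^ℵ₀ : ∣ 𝓛 ℝ𝔻𝕄ℙ ∣ ≃ 2^ℵ₀
  ℝ𝔻𝕄ℙ≃2^ℵ₀ = 𝓛≃2^ℵ₀ ℝ𝔻𝕄ℙ ℝ𝔻𝕄ℙ-isVariety (apartIdentity (starᵗ star)) algebra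
    (λ n → record
      { isDeMorgan         = isDeMorgan n
      ; isPseudocomplement = DeMorganProperties.implication⇒pseudocomplement (algebra n)
          (isDeMorgan n) {_⇒_ n} (⇒-isImplication n (pOps n) (pOps-cong n))
      ; regular            = *-regular n (pOps n) (pOps-cong n)
      })
    (λ m n → shorten⇔ m n ⇔-∘
             apartIdentity⇔ (starᵗ star) em₀ (chain m) (pOps m) (pOps-cong m) (λ _ _ → refl) n)
    em (Countable-⊎ DMOp-countable POp-countable)
    where
    algebra : ℕ → Algebra DMP
    algebra n = expansion n (pOps n) (pOps-cong n)

    isDeMorgan = λ n → expansion-isDeMorgan n (pOps n) (pOps-cong n)

  ℝ𝔻𝕄ℍ≃2^ℵ₀ : ∣ 𝓛 ℝ𝔻𝕄ℍ ∣ ≃ 2^ℵ₀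
  ℝ𝔻𝕄ℍ≃2^ℵ₀ = 𝓛≃2^ℵ₀ ℝ𝔻𝕄ℍ ℝ𝔻𝕄ℍ-isVariety (apartIdentity λ t → impᵗ imp t 0ᵗ) algebra
    (λ n → record
      { isDeMorgan    = expansion-isDeMorgan n (hOps n) (hOps-cong n)
      ; isImplication = ⇒-isImplication n (hOps n) (hOps-cong n)
      ; regular       = *-regular n (hOps n) (hOps-cong n)
      })
    (λ m n → shorten⇔ m n ⇔-∘
             apartIdentity⇔ (λ t → impᵗ imp t 0ᵗ) em₀ (chain m) (hOps m) (hOps-cong m)
               -- The term x → 0 evaluates to `_*` by definition.
               (λ _ _ → refl) n)
    em (Countable-⊎ DMOp-countable HOp-countable)
    where
    algebra : ℕ → Algebra DMH
    algebra n = expansion n (hOps n) (hOps-cong n)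

  ℝ𝔻𝕄𝔻𝔹𝕃ℍ≃2^ℵ₀ : ∣ 𝓛 ℝ𝔻𝕄𝔻𝔹𝕃ℍ ∣ ≃ 2^ℵ₀
  ℝ𝔻𝕄𝔻𝔹𝕃ℍ≃2^ℵ₀ = 𝓛≃2^ℵ₀ ℝ𝔻𝕄𝔻𝔹𝕃ℍ ℝ𝔻𝕄𝔻𝔹𝕃ℍ-isVariety (apartIdentity λ t → impᵗ imp t 0ᵗ) algebra
    (λ n → record
      { isDeMorgan        = isDeMorgan n
      ; isImplication     = isImplication n
      ; isDualImplication = DeMorganProperties.implication⇒dualImplication (algebra n)
          (isDeMorgan n) {_⇒_ n} (isImplication n)
      ; regular           = *-regular n (dblHOps n) (dblHOps-cong n)
      })
    (λ m n → shorten⇔ m n ⇔-∘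
             apartIdentity⇔ (λ t → impᵗ imp t 0ᵗ) em₀ (chain m) (dblHOps m) (dblHOps-cong m)
               (λ _ _ → refl) n)
    em (Countable-⊎ DMOp-countable DblHOp-countable)
    where
    algebra : ℕ → Algebra DMDBLH
    algebra n = expansion n (dblHOps n) (dblHOps-cong n)

    isDeMorgan    = λ n → expansion-isDeMorgan n (dblHOps n) (dblHOps-cong n)
    isImplication = λ n → ⇒-isImplication n (dblHOps n) (dblHOps-cong n)

  ℝ𝔻𝕄𝔻𝔹𝕃ℙ≃2^ℵ₀ : ∣ 𝓛 ℝ𝔻𝕄𝔻𝔹𝕃ℙ ∣ ≃ 2^ℵ₀
  ℝ𝔻𝕄𝔻𝔹𝕃ℙ≃2^ℵ₀ = 𝓛≃2^ℵ₀ ℝ𝔻𝕄𝔻𝔹𝕃ℙ ℝ𝔻𝕄𝔻𝔹𝕃ℙ-isVariety (apartIdentity (starᵗ star)) algebra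
    (λ n → record
      { isDeMorgan             = isDeMorgan n
      ; isPseudocomplement     = isPseudocomplement n
      ; isDualPseudocomplement = DeMorganProperties.pseudocomplement⇒dualPseudocomplement
          (algebra n) (isDeMorgan n) {_* n} (isPseudocomplement n)
      ; regular                = *-regular n (dblPOps n) (dblPOps-cong n)
      })
    (λ m n → shorten⇔ m n ⇔-∘
             apartIdentity⇔ (starᵗ star) em₀ (chain m) (dblPOps m) (dblPOps-cong m)
               (λ _ _ → refl) n)
    em (Countable-⊎ DMOp-countable DblPOp-countable)
    where
    algebra : ℕ → Algebra DMDBLP
    algebra n = expansion n (dblPOps n) (dblPOps-cong n)

    isDeMorgan = λ n → expansion-isDeMorgan n (dblPOps n) (dblPOps-cong n)

    isPseudocomplement = λ n → DeMorganProperties.implication⇒pseudocomplement (algebra n)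
      (isDeMorgan n) {_⇒_ n} (⇒-isImplication n (dblPOps n) (dblPOps-cong n))

≃-cancelʳ : ∀ {a ℓ₁ b ℓ₂ c ℓ₃} {X : Setoid a ℓ₁} {Y : Setoid b ℓ₂} {Z : Setoid c ℓ₃} →
            X ≃ Z → Y ≃ Z → X ≃ Y
≃-cancelʳ X≃Z Y≃Z =
  bijection X≃Z (Inverse.Inverse⇒Bijection (Inverse.sym (Bijection⇒Inverse Y≃Z)))

-- Each equality of cardinals follows by comparing both sides with `2^ℵ₀`.
corollary2p12 : ExcludedMiddle (suc 0ℓ) →
    (∣ 𝓛 ℝ𝔻𝕄ℙ ∣ ≃ ∣ 𝓛 ℝ𝔻𝕄ℍ ∣)
    × (∣ 𝓛 ℝ𝔻𝕄ℍ ∣ ≃ ∣ 𝓛 ℝ𝔻𝕄𝔻𝔹𝕃ℍ ∣)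
    × (∣ 𝓛 ℝ𝔻𝕄𝔻𝔹𝕃ℍ ∣ ≃ ∣ 𝓛 ℝ𝔻𝕄𝔻𝔹𝕃ℙ ∣)
    × (∣ 𝓛 ℝ𝔻𝕄𝔻𝔹𝕃ℙ ∣ ≃ 2^ℵ₀)
corollary2p12 em =
    ≃-cancelʳ (ℝ𝔻𝕄ℙ≃2^ℵ₀ em) (ℝ𝔻𝕄ℍ≃2^ℵ₀ em)
  , ≃-cancelʳ (ℝ𝔻𝕄ℍ≃2^ℵ₀ em) (ℝ𝔻𝕄𝔻𝔹𝕃ℍ≃2^ℵ₀ em)
  , ≃-cancelʳ (ℝ𝔻𝕄𝔻𝔹𝕃ℍ≃2^ℵ₀ em) (ℝ𝔻𝕄𝔻𝔹𝕃ℙ≃2^ℵ₀ em)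
  , ℝ𝔻𝕄𝔻𝔹𝕃ℙ≃2^ℵ₀ em
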